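{- Let $\mathcal{C}$ be a completion-post-effective, $\infty$-completion-effective and positive-effective class of positive very-WSTS. Then the repeated coverability problem is decidable for $\mathcal{C}$: given $\mathcal{S}=(X,\xrightarrow{\Sigma},\le)\in\mathcal{C}$ and $x,y\in X$, one can decide whether $y$ is repeatedly coverable from $x$.
   Context: A (labeled, ordered) transition system is $\mathcal{S}=(X,\xrightarrow{\Sigma},\le)$: $X$ a set, $\Sigma$ a finite alphabet, $\xrightarrow{a}\subseteq X\times X$, $\le$ a quasi-ordering; relations extend to words. $\mathrm{Post}(x,w)=\{y:x\xrightarrow{w}y\}$, extended to sets by union; $\downarrow D=\{x:\exists y\in D,\,x\le y\}$. WSTS: $\le$ a wqo and $x\xrightarrow{a}y$, $x'\ge x$ imply $x'\xrightarrow{w}y'\ge y$ for some $w$. Strong monotonicity: $x\xrightarrow{a}y$, $x'\ge x$ imply $x'\xrightarrow{a}y'$ with $y'\ge y$; strong-strict: additionally $x'>x$ gives $y'>y$. Deterministic: at most one $a$-successor. Ideals: nonempty downward-closed directed subsets, set $\mathrm{Idl}(X)$. Completion $\widehat{\mathcal{S}}=(\mathrm{Idl}(X),\Rightarrow_\Sigma,\subseteq)$ with $I\xRightarrow{a}J$ iff $J$ is a $\subseteq$-maximal ideal included in $\downarrow\mathrm{Post}(I,a)$; if deterministic, $w(I)$ is the unique $J$ with $I\xRightarrow{w}J$. $w^\infty(I)=\bigcup_kw^k(I)$ if $I\subset w(I)$, else $I$. Levels: $\mathrm{Idl}_0(X)=\mathrm{Idl}(X)$, $\mathrm{Idl}_n(X)$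 = unions of strictly increasing sequences in $\mathrm{Idl}_{n-1}(X)$; finitely many levels if some $\mathrm{Idl}_n(X)=\emptyset$. Very-WSTS: WSTS with strong monotonicity whose completion is a deterministic WSTS ($\subseteq$ a wqo on ideals) with strong-strict monotonicity, and $\mathrm{Idl}(X)$ has finitely many levels. Positivity: $w$ is positive for $x$ if $x\xrightarrow{w}z$ for some $z\ge x$; $w$ is positive if positive for every $x$ with $\mathrm{Post}(x,w)\ne\emptyset$; $\mathcal{S}$ is positive if every word positive for some state is positive. $y$ is repeatedly coverable from $x$ if there are $z_0,z_1,\dots$ with $x\xrightarrow{*}z_0\xrightarrow{+}z_1\xrightarrow{+}\cdots$ and $z_i\ge y$ for all $i$. Effectiveness: a class is completion-post-effective if ideals can be effectively represented and manipulated, inclusion of ideals is decidable, and the completion successors of any ideal are computable; $\infty$-completion-effective if $w^\infty(I)$ is computable for every ideal $I$ and word $w$; positive-effective if there is an algorithm deciding, given $\mathcal{S}\in\mathcal{C}$ and a finite automaton $A$ over $\Sigma$, whether the language of $A$ contains a positive word. -}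

module Defs where

open import Data.Bool using (Bool; T)
open import Data.Fin using (Fin)
open import Data.List using (List; []; _∷_; concat; replicate)
open import Data.List.Relation.Unary.Any using (Any)
open import Data.Maybe using (Maybe; just)
open import Data.Nat as ℕ using (ℕ; zero; suc)
open import Data.Product using (Σ-syntax; ∃-syntax; _×_; _,_)
open import Data.Sum using (_⊎_)
open import Function using (_⇔_; _∘_)
open import Level using (Level; 0ℓ; _⊔_) renaming (suc to lsuc)
open import Relation.Binary using (Preorder)
import Relation.Binary.Construct.On as On
open import Relation.Binary.PropositionalEquality using (_≡_; _≢_)
open import Relation.Nullary using (¬_)
open import Relation.Nullary.Reflects using (Reflects)
open import Relation.Unary using (Pred; _∈_; _⊆_; _⊂_; _≐_; ⋃; Satisfiable)
open import Relation.Unary.Relation.Binary.Subset using (⊆-preorder)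

-- The states form a set with an equality _≈_ (a setoid): on the
-- states of a completion, which are ideals, equality is extensional.

record TransitionSystem (c ℓ₁ ℓ₂ ℓ₃ : Level) : Set (lsuc (c ⊔ ℓ₁ ⊔ ℓ₂ ⊔ ℓ₃)) where
  field
    preorder     : Preorder c ℓ₁ ℓ₂
    alphabetSize : ℕ

  open Preorder preorder public
    using (_≈_; isPreorder) renaming (Carrier to State; _≲_ to _≤_)

  Letter : Set
  Letter = Fin alphabetSize

  Word : Set
  Word = List Letter

  infix 4 _—[_]→_ _—[_]→*_ _<_

  field
    _—[_]→_ : State → Letter → State → Set ℓ₃
    —→-resp : ∀ {x x′ a y y′} → x ≈ x′ → y ≈ y′ → x —[ a ]→ y → x′ —[ a ]→ y′

  _<_ : State → State → Set ℓ₂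
  x < y = x ≤ y × ¬ (y ≤ x)

  data _—[_]→*_ : State → Word → State → Set (c ⊔ ℓ₁ ⊔ ℓ₃) where
    done : ∀ {x y} → x ≈ y → x —[ [] ]→* y
    step : ∀ {x y z a w} → x —[ a ]→ y → y —[ w ]→* z → x —[ a ∷ w ]→* z

  Post : State → Word → Pred State (c ⊔ ℓ₁ ⊔ ℓ₃)
  Post x w y = x —[ w ]→* y

  PostSet : ∀ {p} → Pred State p → Letter → Pred State (c ⊔ ℓ₃ ⊔ p)
  PostSet D a y = ∃[ x ] x ∈ D × x —[ a ]→ y

  ↓ : ∀ {p} → Pred State p → Pred State (c ⊔ ℓ₂ ⊔ p)
  ↓ D x = ∃[ y ] y ∈ D × x ≤ y

  WellQuasiOrdered : Set (c ⊔ ℓ₂)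
  WellQuasiOrdered = (s : ℕ → State) → ∃[ i ] ∃[ j ] i ℕ.< j × s i ≤ s j

  Monotone : Set (c ⊔ ℓ₁ ⊔ ℓ₂ ⊔ ℓ₃)
  Monotone = ∀ {x a y x′} → x —[ a ]→ y → x ≤ x′ →
             ∃[ w ] ∃[ y′ ] x′ —[ w ]→* y′ × y ≤ y′

  StronglyMonotone : Set (c ⊔ ℓ₂ ⊔ ℓ₃)
  StronglyMonotone = ∀ {x a y x′} → x —[ a ]→ y → x ≤ x′ →
                     ∃[ y′ ] x′ —[ a ]→ y′ × y ≤ y′

  StrongStrictlyMonotone : Set (c ⊔ ℓ₂ ⊔ ℓ₃)
  StrongStrictlyMonotone =
    StronglyMonotone ×
    (∀ {x a y x′} → x —[ a ]→ y → x < x′ → ∃[ y′ ] x′ —[ a ]→ y′ × y < y′)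

  IsWSTS : Set (c ⊔ ℓ₁ ⊔ ℓ₂ ⊔ ℓ₃)
  IsWSTS = WellQuasiOrdered × Monotone

  Deterministic : Set (c ⊔ ℓ₁ ⊔ ℓ₃)
  Deterministic = ∀ {x a y y′} → x —[ a ]→ y → x —[ a ]→ y′ → y ≈ y′

  PositiveFor : State → Word → Set (c ⊔ ℓ₁ ⊔ ℓ₂ ⊔ ℓ₃)
  PositiveFor x w = ∃[ z ] x —[ w ]→* z × x ≤ z

  PositiveWord : Word → Set (c ⊔ ℓ₁ ⊔ ℓ₂ ⊔ ℓ₃)
  PositiveWord w = ∀ x → Satisfiable (Post x w) → PositiveFor x w

  Positive : Set (c ⊔ ℓ₁ ⊔ ℓ₂ ⊔ ℓ₃)
  Positive = ∀ w → (∃[ x ] PositiveFor x w) → PositiveWord w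

  RepeatedlyCoverable : State → State → Set (c ⊔ ℓ₁ ⊔ ℓ₂ ⊔ ℓ₃)
  RepeatedlyCoverable x y =
    Σ[ z ∈ (ℕ → State) ]
      (∃[ w ] x —[ w ]→* z 0) ×
      (∀ i → ∃[ w ] w ≢ [] × z i —[ w ]→* z (suc i)) ×
      (∀ i → y ≤ z i)

System : Set₁
System = TransitionSystem 0ℓ 0ℓ 0ℓ 0ℓ

module Completion (S : System) where
  open TransitionSystem S

  record Ideal : Set₁ where
    field
      members        : Pred State 0ℓ
      nonempty       : Satisfiable members
      downwardClosed : ∀ {x y} → x ≤ y → y ∈ members → x ∈ members
      directed       : ∀ {x y} → x ∈ members → y ∈ members →
                       ∃[ z ] z ∈ members × x ≤ z × y ≤ z

  open Ideal public

  MaximalIdealIn : Pred State 0ℓ → Ideal → Set₁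
  MaximalIdealIn D J =
    members J ⊆ D ×
    (∀ K → members K ⊆ D → members J ⊆ members K → members K ⊆ members J)

  infix 4 _=[_]⇒_

  _=[_]⇒_ : Ideal → Letter → Ideal → Set₁
  I =[ a ]⇒ J = MaximalIdealIn (↓ (PostSet (members I) a)) J

  ⇒-resp : ∀ {I I′ a J J′} → members I ≐ members I′ → members J ≐ members J′ →
           I =[ a ]⇒ J → I′ =[ a ]⇒ J′
  ⇒-resp {I} {I′} {a} (I⊆I′ , I′⊆I) (J⊆J′ , J′⊆J) (J⊆D , J-max) =
    (λ x∈J′ → mono I⊆I′ (J⊆D (J′⊆J x∈J′))) ,
    λ K K⊆D′ J′⊆K x∈K →
      J⊆J′ (J-max K (λ y∈K → mono I′⊆I (K⊆D′ y∈K)) (λ y∈J → J′⊆K (J⊆J′ y∈J)) x∈K)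
    where
    mono : {P Q : Pred State 0ℓ} → P ⊆ Q →
           ↓ (PostSet P a) ⊆ ↓ (PostSet Q a)
    mono P⊆Q (y , (x , x∈P , x→y) , z≤y) = y , (x , P⊆Q x∈P , x→y) , z≤y

  completion : TransitionSystem (lsuc 0ℓ) 0ℓ 0ℓ (lsuc 0ℓ)
  completion = record
    { preorder     = On.preorder (⊆-preorder State 0ℓ) members
    ; alphabetSize = alphabetSize
    ; _—[_]→_      = _=[_]⇒_
    ; —→-resp      = λ {I} {I′} {a} {J} {J′} → ⇒-resp {I} {I′} {a} {J} {J′}
    }

  module Ŝ = TransitionSystem completion

  -- IsLimit w I K says that K = w^∞(I). The ideal w(I) need not exist;
  -- the condition I ⊂ w(I) fails when it does not.

  _GrowsBy_ : Ideal → Word → Set₁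
  I GrowsBy w = ∃[ J ] I Ŝ.—[ w ]→* J × members I ⊂ members J

  Iterates : Word → Ideal → Pred State (lsuc 0ℓ)
  Iterates w I x =
    ∃[ k ] ∃[ J ] I Ŝ.—[ concat (replicate k w) ]→* J × x ∈ members J

  IsLimit : Word → Ideal → Pred State 0ℓ → Set₁
  IsLimit w I K = (I GrowsBy w × K ≐ Iterates w I) ⊎ (¬ (I GrowsBy w) × K ≐ members I)

  data InLevel : ℕ → Ideal → Set₁ where
    base  : ∀ {I} → InLevel zero I
    union : ∀ {n I} (s : ℕ → Ideal) →
            (∀ k → InLevel n (s k)) →
            (∀ k → members (s k) ⊂ members (s (suc k))) →
            members I ≐ ⋃ ℕ (members ∘ s) →
            InLevel (suc n) I

  FinitelyManyLevels : Set₁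
  FinitelyManyLevels = ∃[ n ] (∀ I → ¬ InLevel n I)

record IsVeryWSTS (S : System) : Set₁ where
  open TransitionSystem S
  open Completion S
  field
    isWSTS                   : IsWSTS
    stronglyMonotone         : StronglyMonotone
    completionIsWSTS         : Ŝ.IsWSTS
    completionDeterministic  : Ŝ.Deterministic
    completionStrictMonotone : Ŝ.StrongStrictlyMonotone
    finitelyManyLevels       : FinitelyManyLevels

record NFA (k : ℕ) : Set where
  field
    size    : ℕ
    initial : Fin size → Bool
    final   : Fin size → Bool
    δ       : Fin size → Fin k → Fin size → Bool

  AcceptsFrom : Fin size → List (Fin k) → Set
  AcceptsFrom q []      = T (final q)
  AcceptsFrom q (a ∷ w) = ∃[ r ] T (δ q a r) × AcceptsFrom r w

  Accepts : List (Fin k) → Set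
  Accepts w = ∃[ q ] T (initial q) × AcceptsFrom q w

-- Decidability is a property of algorithms, and the mathematics is
-- classical. An algorithm is therefore a function definable without
-- excluded middle; excluded middle is available only for showing that
-- it halts and answers correctly. Since halting may have a classical
-- proof, algorithms are possibly non-terminating: m n is the output
-- after n units of time, or nothing if there is none.

Computation : Set → Set
Computation A = ℕ → Maybe A

_⇓_ : {A : Set} → Computation A → A → Set
m ⇓ v = ∃[ n ] m n ≡ just v

_Computes_ : {A : Set} {p : Level} → Computation A → Pred A p → Set p
m Computes P = (∃[ v ] m ⇓ v) × (∀ v → m ⇓ v → P v)

_Decides_ : {p : Level} → Computation Bool → Set p → Set p
m Decides P = m Computes Reflects P

record Class : Set₁ where
  field
    Name   : Set
    system : Name → System

  module _ (i : Name) where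
    open TransitionSystem (system i) public using ()
      renaming (State to StateOf; Letter to LetterOf; Word to WordOf; alphabetSize to alphabetSizeOf)

-- The algorithms alone. What they are required to compute is stated
-- separately, so that a program using them has no access to the
-- content of the proofs.

record Algorithms (C : Class) : Set₁ where
  open Class C
  field
    Code       : Name → Set
    ⟦_⟧        : ∀ {i} → Code i → Pred (StateOf i) 0ℓ
    principal  : ∀ i → StateOf i → Computation (Code i)
    included   : ∀ i → Code i → Code i → Computation Bool
    successors : ∀ i → Code i → LetterOf i → Computation (List (Code i))
    limit      : ∀ i → Code i → WordOf i → Computation (Code i)
    positive   : ∀ i → NFA (alphabetSizeOf i) → Computation Bool

module Effectiveness {C : Class} (A : Algorithms C) where
  open Class C
  open Algorithms A

  module _ (i : Name) where
    open TransitionSystem (system i)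
    open Completion (system i)

    record CompletionPostEffectiveAt : Set₁ where
      field
        sound  : ∀ (u : Code i) → ∃[ I ] members I ≐ ⟦ u ⟧
        onto   : ∀ I → Σ[ u ∈ Code i ] members I ≐ ⟦ u ⟧
        principal-correct  : ∀ x → principal i x Computes λ u → ⟦ u ⟧ ≐ ↓ (x ≡_)
        included-correct   : ∀ u v → included i u v Decides (⟦ u ⟧ ⊆ ⟦ v ⟧)
        successors-correct : ∀ u I → members I ≐ ⟦ u ⟧ → ∀ a →
          successors i u a Computes λ vs →
            (∀ J → I =[ a ]⇒ J ⇔ Any (λ v → members J ≐ ⟦ v ⟧) vs)

    ∞-CompletionEffectiveAt : Set₁
    ∞-CompletionEffectiveAt = ∀ u I → members I ≐ ⟦ u ⟧ → ∀ w →
      limit i u w Computes λ v → IsLimit w I ⟦ v ⟧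

    PositiveEffectiveAt : Set
    PositiveEffectiveAt = ∀ B →
      positive i B Decides (∃[ w ] NFA.Accepts B w × PositiveWord w)

  CompletionPostEffective : Set₁
  CompletionPostEffective = ∀ i → CompletionPostEffectiveAt i

  ∞-CompletionEffective : Set₁
  ∞-CompletionEffective = ∀ i → ∞-CompletionEffectiveAt i

  PositiveEffective : Set
  PositiveEffective = ∀ i → PositiveEffectiveAt i

{-# OPTIONS --safe #-}

-- Call an ideal accelerated if it arises from ↓x by taking successors
-- and limits w^∞. A certificate is a sequence of finite sets (layers)
-- of accelerated ideals, one of them containing x, such that every
-- successor of an ideal of a layer is equal to an ideal of this layer
-- or included in an ideal of a later one. Then y is repeatedly coverable
-- from x iff in some layer a nonempty positive word can be read, along
-- edges that are exact successors, from an ideal I ∋ y: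
--
--   if so, the accelerated ideal I contains only states coverable from
--   x, and by directedness one of them is above y and above a state
--   enabling w, so that w can be repeated from it forever;
--
--   conversely an infinite run eventually stays in one layer, where it
--   follows exact edges, and it has k < l with z_k ≤ z_l.
--
-- Each layer is a finite automaton, so the condition can be decided. It
-- remains to search for a certificate, and the Karp-Miller construction
-- shows that there is one: explore exact successors, stopping at an ideal
-- that includes an earlier one on its path. In case of equality nothing is
-- added; otherwise the acceleration goes to the next layer. Paths are
-- finite because ⊆ is a well-quasi-ordering, and the layers are finitely
-- many because successors preserve the level of ideals and accelerations
-- raise it.

module Submission where

open import Defs
open import Axiom.ExcludedMiddle using (ExcludedMiddle)
open import Data.Bool using (Bool; true; false; T; if_then_else_; _∧_; _∨_)
open import Data.Empty using (⊥-elim)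
open import Data.Fin using (Fin; zero; suc)
open import Data.List using (List; []; _∷_; _++_; allFin; concat; concatMap; fromMaybe; head; length; lookup; replicate; upTo)
open import Data.List.Membership.Propositional using (find; lose) renaming (_∈_ to _∈ᴸ_)
open import Data.List.Membership.Propositional.Properties using (∈-allFin; ∈-concatMap⁺; ∈-concatMap⁻; ∈-lookup; ∈-upTo⁺)
open import Data.List.Properties using (++-identityʳ)
open import Data.List.Relation.Unary.All as All using (All; []; _∷_)
import Data.List.Relation.Unary.All.Properties as All
open import Data.List.Relation.Unary.Any as Any using (Any; here; there; index)
open import Data.List.Relation.Unary.Any.Properties using (lookup-index; ++⁺ˡ; ++⁺ʳ; ++⁻)
open import Data.Maybe using (just)
open import Data.Nat as ℕ using (ℕ; zero; suc; s≤s)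
import Data.Nat.Properties as ℕ
open import Data.Product using (Σ-syntax; ∃-syntax; _×_; _,_; proj₁; proj₂)
open import Data.Sum using (_⊎_; inj₁; inj₂)
open import Data.Vec.Functional using () renaming (_∷_ to _∷ᶠ_)
open import Function using (_∘_; case_of_; id; _⇔_; Equivalence; mk⇔)
open import Level using (Level; 0ℓ; Lift; lift; lower) renaming (suc to lsuc)
open import Relation.Binary.PropositionalEquality using (_≡_; _≢_; refl; sym; subst)
open import Relation.Binary.Structures using (IsPreorder)
open import Relation.Nullary using (¬_; yes; no; contradiction)
open import Relation.Nullary.Decidable using (decidable-stable; map′)
open import Relation.Nullary.Reflects using (Reflects; of; ofʸ; ofⁿ; _×-reflects_; _⊎-reflects_)
open import Relation.Unary using (Pred; _∈_; _⊆_; _⊂_; _≐_; ⋃)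
open import Relation.Unary.Properties using (≐-trans)

-- Nondeterministic algorithms: the possible outputs of e are the
-- elements of the lists e 0, e 1, ….

record Enum (A : Set) : Set where
  no-eta-equality
  field outputs : ℕ → List A

open Enum

private variable
  p q c ℓ₁ ℓ₂ ℓ₃ : Level
  A B : Set

infix 4 _∈ₑ_ _Yields_
infixl 1 _>>=_
infixr 6 _∧ₑ_
infixr 5 _∨ₑ_

data _∈ₑ_ {A : Set} (v : A) (e : Enum A) : Set where
  output : ∀ n → v ∈ᴸ outputs e n → v ∈ₑ e

choose : List A → Enum A
choose vs .outputs _ = vs

return : A → Enum A
return v = choose (v ∷ [])

-- Dovetailing: a given stage of `e` or `f v` may be empty, and stages need not grow, so stage `n`
-- combines all pairs of stages below `n`.
_>>=_ : Enum A → (A → Enum B) → Enum B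
(e >>= f) .outputs n =
  concatMap (λ i → concatMap (λ v → concatMap (outputs (f v)) (upTo n)) (outputs e i)) (upTo n)

run : Computation A → Enum A
run m .outputs n = fromMaybe (m n)

first : Enum A → Computation A
first e n = head (outputs e n)

∈-choose : {v : A} {vs : List A} → v ∈ᴸ vs → v ∈ₑ choose vs
∈-choose v∈ = output 0 v∈

∈-return : {v : A} → v ∈ₑ return v
∈-return = ∈-choose (here refl)

∈->>= : {e : Enum A} {f : A → Enum B} {v : A} {u : B} →
        v ∈ₑ e → u ∈ₑ f v → u ∈ₑ (e >>= f)
∈->>= (output i v∈) (output j u∈) = output n
  (∈-concatMap⁺ _ (lose (∈-upTo⁺ {n} {i} (s≤s (ℕ.m≤m⊔n i j)))
    (∈-concatMap⁺ _ (lose v∈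
      (∈-concatMap⁺ _ (lose (∈-upTo⁺ {n} {j} (s≤s (ℕ.m≤n⊔m i j))) u∈))))))
  where
  n : ℕ
  n = suc (i ℕ.⊔ j)

>>=-∈ : {e : Enum A} {f : A → Enum B} {u : B} →
        u ∈ₑ (e >>= f) → ∃[ v ] v ∈ₑ e × u ∈ₑ f v
>>=-∈ {e = e} {f} (output n u∈)
  with i , _ , u∈ᵢ ← find (∈-concatMap⁻ _ {xs = upTo n} u∈)
  with v , v∈ , u∈ᵥ ← find (∈-concatMap⁻ _ {xs = outputs e i} u∈ᵢ)
  with j , _ , u∈ⱼ ← find (∈-concatMap⁻ (outputs (f v)) {xs = upTo n} u∈ᵥ)
  = v , output i v∈ , output j u∈ⱼ

-- Counterpart of `_Computes_`: an output must exist, which may be known only classically, and many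
-- outputs are allowed as long as each is correct.
_Yields_ : Enum A → Pred A p → Set p
e Yields P = (∃[ v ] v ∈ₑ e) × (∀ v → v ∈ₑ e → P v)

run-∈ : {m : Computation A} {v : A} → v ∈ₑ run m → m ⇓ v
run-∈ {m = m} (output n v∈) with m n in eq | v∈
... | just _ | here refl = n , eq

∈-run : {m : Computation A} {v : A} → m ⇓ v → v ∈ₑ run m
∈-run {m = m} {v} (n , eq) = output n (subst (λ r → v ∈ᴸ fromMaybe r) (sym eq) (here refl))

run-yields : {m : Computation A} {P : Pred A p} → m Computes P → run m Yields P
run-yields ((v , v⇓) , correct) = (v , ∈-run v⇓) , λ u u∈ → correct u (run-∈ u∈)

head-∈ : {vs : List A} {v : A} → head vs ≡ just v → v ∈ᴸ vs
head-∈ {vs = _ ∷ _} refl = here refl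

∈-head : {vs : List A} {v : A} → v ∈ᴸ vs → ∃[ u ] head vs ≡ just u
∈-head (here _)  = _ , refl
∈-head (there _) = _ , refl

-- Different stages may have different heads. This is harmless, since `_Computes_` asks each output
-- to be correct and not that it be unique.
first-computes : {e : Enum A} {P : Pred A p} → e Yields P → first e Computes P
first-computes ((_ , output n v∈) , correct) =
  (proj₁ (∈-head v∈) , n , proj₂ (∈-head v∈)) ,
  λ u (k , eq) → correct u (output k (head-∈ eq))

return-yields : {P : Pred A p} {v : A} → P v → return v Yields P
return-yields Pv = (_ , ∈-return) , λ { _ (output _ (here refl)) → Pv }

>>=-yields : {e : Enum A} {f : A → Enum B} {P : Pred A p} {Q : Pred B q} →
             e Yields P → (∀ v → P v → f v Yields Q) → (e >>= f) Yields Q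
>>=-yields {f = f} ((v , v∈) , correct) fv =
  (_ , ∈->>= {f = f} v∈ (proj₂ (proj₁ (fv v (correct v v∈))))) ,
  λ u u∈ → let (v′ , v′∈ , u∈′) = >>=-∈ {f = f} u∈ in proj₂ (fv v′ (correct v′ v′∈)) u u∈′

weaken : {e : Enum A} {P : Pred A p} {Q : Pred A q} →
         (∀ {v} → P v → Q v) → e Yields P → e Yields Q
weaken P⇒Q (out , correct) = out , λ v v∈ → P⇒Q (correct v v∈)

-- Enumeration of lists and finite tables, and Boolean tests.

vectors : Enum A → ℕ → Enum (List A)
vectors e zero    = return []
vectors e (suc n) = e >>= λ v → vectors e n >>= λ vs → return (v ∷ vs)

naturals : Enum ℕ
naturals .outputs n = n ∷ []

listOf : Enum A → Enum (List A)
listOf e = naturals >>= vectors e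

∈-listOf : {e : Enum A} {vs : List A} → All (_∈ₑ e) vs → vs ∈ₑ listOf e
∈-listOf {e = e} {vs} vs∈ = ∈->>= {v = length vs} (output _ (here refl)) (∈-vectors vs∈)
  where
  ∈-vectors : ∀ {vs} → All (_∈ₑ e) vs → vs ∈ₑ vectors e (length vs)
  ∈-vectors []          = ∈-return
  ∈-vectors (v∈ ∷ vs∈) = ∈->>= v∈ (∈->>= (∈-vectors vs∈) ∈-return)

listOf-∈ : {e : Enum A} {vs : List A} → vs ∈ₑ listOf e → All (_∈ₑ e) vs
listOf-∈ {e = e} vs∈ with n , _ , vs∈ₙ ← >>=-∈ {f = vectors e} vs∈ = vectors-∈ n vs∈ₙ
  where
  vectors-∈ : ∀ n {vs} → vs ∈ₑ vectors e n → All (_∈ₑ e) vs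
  vectors-∈ zero (output _ (here refl)) = []
  vectors-∈ (suc n) vs∈
    with _ , v∈ , vs∈′ ← >>=-∈ {e = e} vs∈
    with _ , us∈ , (output _ (here refl)) ← >>=-∈ {e = vectors e n} vs∈′ = v∈ ∷ vectors-∈ n us∈

table : ∀ {n} → (Fin n → Enum A) → Enum (Fin n → A)
table {n = zero}  f = return λ ()
table {n = suc n} f = f zero >>= λ v → table (f ∘ suc) >>= λ g → return (v ∷ᶠ g)

table-yields : ∀ {n} {f : Fin n → Enum A} {P : Fin n → Pred A p} →
               (∀ k → f k Yields P k) → table f Yields (λ g → ∀ k → P k (g k))
table-yields {n = zero}  _  = return-yields λ ()
table-yields {n = suc n} fs =
  >>=-yields (fs zero) λ _ Pv → >>=-yields (table-yields (fs ∘ suc)) λ _ Pg →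
  return-yields λ { zero → Pv ; (suc k) → Pg k }

_∧ₑ_ _∨ₑ_ : Enum Bool → Enum Bool → Enum Bool
e ∧ₑ e′ = e >>= λ b → e′ >>= λ b′ → return (b ∧ b′)
e ∨ₑ e′ = e >>= λ b → e′ >>= λ b′ → return (b ∨ b′)

all any : (A → Enum Bool) → List A → Enum Bool
all f []       = return true
all f (v ∷ vs) = f v ∧ₑ all f vs
any f []       = return false
any f (v ∷ vs) = f v ∨ₑ any f vs

reflects-⇔ : ∀ {P : Set p} {Q : Set q} {b} → P ⇔ Q → Reflects P b → Reflects Q b
reflects-⇔ P⇔Q (ofʸ x)  = of (Equivalence.to P⇔Q x)
reflects-⇔ P⇔Q (ofⁿ ¬x) = of (¬x ∘ Equivalence.from P⇔Q)

∧-yields : ∀ {P : Set p} {Q : Set q} {e e′} →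
           e Yields Reflects P → e′ Yields Reflects Q → e ∧ₑ e′ Yields Reflects (P × Q)
∧-yields d d′ = >>=-yields d λ _ r → >>=-yields d′ λ _ r′ → return-yields (r ×-reflects r′)

∨-yields : ∀ {P : Set p} {Q : Set q} {e e′} →
           e Yields Reflects P → e′ Yields Reflects Q → e ∨ₑ e′ Yields Reflects (P ⊎ Q)
∨-yields d d′ = >>=-yields d λ _ r → >>=-yields d′ λ _ r′ → return-yields (r ⊎-reflects r′)

all-yields : {P : Pred A p} {f : A → Enum Bool} → (∀ v → f v Yields Reflects (P v)) →
             ∀ vs → all f vs Yields Reflects (All P vs)
all-yields fv []       = return-yields (of [])
all-yields fv (v ∷ vs) =
  weaken (reflects-⇔ (mk⇔ (λ (x , xs) → x ∷ xs) All.uncons)) (∧-yields (fv v) (all-yields fv vs))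

any-yields : {P : Pred A p} {f : A → Enum Bool} → (∀ v → f v Yields Reflects (P v)) →
             ∀ vs → any f vs Yields Reflects (Any P vs)
any-yields fv []       = return-yields (of λ ())
any-yields fv (v ∷ vs) =
  weaken (reflects-⇔ (mk⇔ Any.fromSum Any.toSum)) (∨-yields (fv v) (any-yields fv vs))

-- Ideals of a very-WSTS

module Paths (T : TransitionSystem c ℓ₁ ℓ₂ ℓ₃) where
  open TransitionSystem T
  open IsPreorder isPreorder using () renaming
    (refl to ≤-refl; trans to ≤-trans; reflexive to ≤-reflexive; module Eq to ≈)

  infixr 5 _++→_

  →*-respˡ : ∀ {x x′ y w} → x ≈ x′ → x —[ w ]→* y → x′ —[ w ]→* y
  →*-respˡ x≈x′ (done x≈y)    = done (≈.trans (≈.sym x≈x′) x≈y)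
  →*-respˡ x≈x′ (step x→y ys) = step (—→-resp x≈x′ ≈.refl x→y) ys

  _++→_ : ∀ {x y z v w} → x —[ v ]→* y → y —[ w ]→* z → x —[ v ++ w ]→* z
  done x≈y ++→ zs = →*-respˡ (≈.sym x≈y) zs
  step x→y ys ++→ zs = step x→y (ys ++→ zs)

  single : ∀ {x y a} → x —[ a ]→ y → x —[ a ∷ [] ]→* y
  single x→y = step x→y (done ≈.refl)

  monotone* : StronglyMonotone → ∀ {x y x′ w} → x —[ w ]→* y → x ≤ x′ →
              ∃[ y′ ] x′ —[ w ]→* y′ × y ≤ y′
  monotone* mono (done x≈y) x≤x′ =
    _ , done ≈.refl , ≤-trans (≤-reflexive (≈.sym x≈y)) x≤x′
  monotone* mono (step x→y ys) x≤x′ =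
    let (y′ , x′→y′ , y≤y′) = mono x→y x≤x′
        (z′ , zs , z≤z′)    = monotone* mono ys y≤y′
    in z′ , step x′→y′ zs , z≤z′

  strictlyMonotone* : StrongStrictlyMonotone → ∀ {x y x′ w} → x —[ w ]→* y → x < x′ →
                      ∃[ y′ ] x′ —[ w ]→* y′ × y < y′
  strictlyMonotone* _ (done x≈y) (x≤x′ , x′≰x) =
    _ , done ≈.refl ,
    ≤-trans (≤-reflexive (≈.sym x≈y)) x≤x′ ,
    λ x′≤y → x′≰x (≤-trans x′≤y (≤-reflexive (≈.sym x≈y)))
  strictlyMonotone* mono (step x→y ys) x<x′ =
    let (y′ , x′→y′ , y<y′) = proj₂ mono x→y x<x′
        (z′ , zs , z<z′)    = strictlyMonotone* mono ys y<y′
    in z′ , step x′→y′ zs , z<z′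

-- Infinite sequences are built by iterating a function on elements that carry their own invariants,
-- which takes the place of dependent choice.
module Orbit {a} {A : Set a} (next : A → A) where

  iterate : ℕ → A → A
  iterate zero    x = x
  iterate (suc k) x = iterate k (next x)

  orbit-step : ∀ {r} (R : A → A → Set r) → (∀ x → R x (next x)) →
               ∀ k x → R (iterate k x) (iterate (suc k) x)
  orbit-step R R-next zero    x = R-next x
  orbit-step R R-next (suc k) x = orbit-step R R-next k (next x)

module Ideals (S : System) where
  open TransitionSystem S
  open Completion S
  open IsPreorder isPreorder using () renaming (refl to ≤-refl; trans to ≤-trans)

  principalIdeal : State → Ideal
  principalIdeal x = record
    { members        = _≤ x
    ; nonempty       = x , ≤-refl
    ; downwardClosed = ≤-trans
    ; directed       = λ y≤x z≤x → x , ≤-refl , y≤x , z≤x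
    }

  module _ (s : ℕ → Ideal) (increasing : ∀ k → members (s k) ⊆ members (s (suc k))) where

    chain-⊆ : ∀ {k l} → k ℕ.≤ l → members (s k) ⊆ members (s l)
    chain-⊆ k≤l = go (ℕ.≤⇒≤′ k≤l)
      where
      go : ∀ {k l} → k ℕ.≤′ l → members (s k) ⊆ members (s l)
      go (ℕ.≤′-reflexive refl) = id
      go (ℕ.≤′-step k≤l) x∈    = increasing _ (go k≤l x∈)

    unionIdeal : Ideal
    unionIdeal = record
      { members        = ⋃ ℕ (members ∘ s)
      ; nonempty       = let (x , x∈) = nonempty (s 0) in x , 0 , x∈
      ; downwardClosed = λ { x≤y (k , y∈) → k , downwardClosed (s k) x≤y y∈ }
      ; directed       = λ { (k , x∈) (l , y∈) →
          let (z , z∈ , x≤z , y≤z) = directed (s (k ℕ.⊔ l))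
                (chain-⊆ (ℕ.m≤m⊔n k l) x∈) (chain-⊆ (ℕ.m≤n⊔m k l) y∈)
          in z , (k ℕ.⊔ l , z∈) , x≤z , y≤z }
      }

  inLevel-resp : ∀ {n I J} → members I ≐ members J → InLevel n I → InLevel n J
  inLevel-resp _   base                          = base
  inLevel-resp (I⊆J , J⊆I) (union s levels strict (I⊆⋃ , ⋃⊆I)) =
    union s levels strict ((λ x∈J → I⊆⋃ (J⊆I x∈J)) , λ x∈⋃ → I⊆J (⋃⊆I x∈⋃))

module Classical (em : ExcludedMiddle (lsuc 0ℓ)) where

  em₀ : ExcludedMiddle 0ℓ
  em₀ {P} = map′ lower lift (em {Lift (lsuc 0ℓ) P})

module VeryWSTS (em : ExcludedMiddle (lsuc 0ℓ)) {S : System} (V : IsVeryWSTS S) where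
  open TransitionSystem S
  open Completion S
  open IsVeryWSTS V
  open IsPreorder isPreorder using () renaming
    (refl to ≤-refl; trans to ≤-trans; reflexive to ≤-reflexive; module Eq to ≈)
  open Classical em
  open Ideals S
  open Paths S
  module P̂ = Paths completion

  -- If no ideal above J were maximal in D, there would be strictly
  -- increasing sequences of ideals in D, and then of their unions, and
  -- so on, hence ideals of every level.
  maximalIdealAbove : (D : Pred State 0ℓ) (J : Ideal) → members J ⊆ D →
                      ∃[ K ] MaximalIdealIn D K × members J ⊆ members K
  maximalIdealAbove D J J⊆D = decidable-stable em λ none →
    let (N , empty)    = finitelyManyLevels
        (K , K-lvl , _) = bigger none N (J , J⊆D , id)
    in empty K K-lvl
    where
    Above : Set₁
    Above = ∃[ K ] members K ⊆ D × members J ⊆ members K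

    module _ (none : ¬ (∃[ K ] MaximalIdealIn D K × members J ⊆ members K)) where

      bigger : ∀ n (K : Above) →
               ∃[ K′ ] InLevel n K′ × members K′ ⊆ D × members (proj₁ K) ⊂ members K′
      bigger zero (K , K⊆D , J⊆K)
        with em {∃[ K′ ] InLevel zero K′ × members K′ ⊆ D × members K ⊂ members K′}
      ... | yes K′ = K′
      -- Without a strict extension inside `D`, the ideal `K` is itself maximal in `D`.
      ... | no  ¬K′ = ⊥-elim (none
        (K , (K⊆D , λ K′ K′⊆D K⊆K′ → λ {x} x∈K′ → decidable-stable (em₀ {x ∈ members K}) λ x∉K →
               ¬K′ (K′ , base , K′⊆D , K⊆K′ , λ K′⊆K → x∉K (K′⊆K x∈K′))) , J⊆K))
      bigger (suc n) K =
        unionIdeal s (λ k → proj₁ (strict k)) ,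
        union s levels strict (id , id) ,
        (λ (k , x∈) → proj₁ (proj₂ (seq k)) x∈) ,
        (λ x∈ → 0 , proj₁ (grow K) x∈) ,
        λ ⋃⊆K → proj₂ (grow K) (λ x∈ → ⋃⊆K (0 , x∈))
        where
        next : Above → Above
        next K = let (K′ , _ , K′⊆D , K⊆K′ , _) = bigger n K in
          K′ , K′⊆D , λ x∈J → K⊆K′ (proj₂ (proj₂ K) x∈J)
        grow : ∀ K → members (proj₁ K) ⊂ members (proj₁ (next K))
        grow K = proj₂ (proj₂ (proj₂ (bigger n K)))
        open Orbit next
        -- The sequence starts at `next K`: only ideals produced by `bigger n` are known to have
        -- level `n`, while `K` is arbitrary.
        seq : ℕ → Above
        seq k = iterate k (next K)
        s : ℕ → Ideal
        s k = proj₁ (seq k)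
        strict : ∀ k → members (s k) ⊂ members (s (suc k))
        strict k = orbit-step (λ K K′ → members (proj₁ K) ⊂ members (proj₁ K′)) grow k (next K)
        levels : ∀ k → InLevel n (s k)
        levels k = go k K
          where
          go : ∀ k K → InLevel n (proj₁ (iterate k (next K)))
          go zero    K = proj₁ (proj₂ (bigger n K))
          go (suc k) K = go k (next K)

  -- Successors, limits and levels.

  successorAround : ∀ {I r a r′} → r ∈ members I → r —[ a ]→ r′ →
                    ∃[ J ] I =[ a ]⇒ J × r′ ∈ members J
  successorAround {I} {r} {a} {r′} r∈I r→r′ =
    -- The principal ideal of `r′` lies in the downward closure of the successors of `I`, and a
    -- maximal ideal above it is a completion successor.
    let (J , J-max , ↓r′⊆J) = maximalIdealAbove (↓ (PostSet (members I) a)) (principalIdeal r′)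
                                (λ z≤r′ → r′ , (r , r∈I , r→r′) , z≤r′)
    in J , J-max , ↓r′⊆J ≤-refl

  -- Some successor ideal contains `r′`, and by determinism it is `J`.
  successor∋ : ∀ {I r a r′ J} → r ∈ members I → r —[ a ]→ r′ → I =[ a ]⇒ J → r′ ∈ members J
  successor∋ {I} {J = J} r∈I r→r′ I⇒J =
    let (J′ , I⇒J′ , r′∈J′) = successorAround {I} r∈I r→r′
    in proj₁ (completionDeterministic {I} {y = J′} {J} I⇒J′ I⇒J) r′∈J′

  -- Strict monotonicity sends a strict chain with union `I` to a strict chain of successors. Their
  -- union is an ideal in the downward closure of the successors of `I` that contains `J`, so by
  -- maximality it equals `J`.
  successor-level : ∀ {n I a J} → I =[ a ]⇒ J → InLevel n I → InLevel n J
  successor-level {zero} _ _ = base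
  successor-level {suc n} {I} {a} {J} (J⊆D , J-max) (union s levels strict (I⊆⋃ , ⋃⊆I)) =
    union t t-levels t-strict
      (J⊆⋃ , J-max (unionIdeal t (λ k → proj₁ (t-strict k))) ⋃⊆D J⊆⋃)
    where
    -- Early ideals of the chain may have no successor. A member of `J` lies below a successor of
    -- some `r` in `I`, and `r` lies in some `s k`; from this index on, monotonicity provides
    -- successors.
    start : ∃[ k ] ∃[ K ] s k =[ a ]⇒ K
    start with j , j∈J ← nonempty J
          with r′ , (r , r∈I , r→r′) , _ ← J⊆D j∈J
          with k , r∈ ← I⊆⋃ r∈I
          with K , s⇒K , _ ← successorAround {s k} r∈ r→r′ = k , K , s⇒K
    k₀ : ℕ
    k₀ = proj₁ start
    image : ∀ k → ∃[ K ] s (k ℕ.+ k₀) =[ a ]⇒ K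
    image zero    = proj₂ start
    image (suc k) =
      let (K , s⇒K)       = image k
          (K′ , s⇒K′ , _) = proj₂ completionStrictMonotone
            {s (k ℕ.+ k₀)} {a} {K} {s (suc k ℕ.+ k₀)} s⇒K (strict (k ℕ.+ k₀))
      in K′ , s⇒K′
    t : ℕ → Ideal
    t k = proj₁ (image k)
    t-levels : ∀ k → InLevel n (t k)
    t-levels k = successor-level {I = s (k ℕ.+ k₀)} {J = t k} (proj₂ (image k)) (levels (k ℕ.+ k₀))
    t-strict : ∀ k → members (t k) ⊂ members (t (suc k))
    t-strict k = proj₂ (proj₂ (proj₂ completionStrictMonotone
      {s (k ℕ.+ k₀)} {a} {t k} {s (suc k ℕ.+ k₀)} (proj₂ (image k)) (strict (k ℕ.+ k₀))))
    ⋃⊆D : ⋃ ℕ (members ∘ t) ⊆ ↓ (PostSet (members I) a)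
    ⋃⊆D (k , x∈) = let (r′ , (r , r∈ , r→r′) , x≤r′) = proj₁ (proj₂ (image k)) x∈
                   in r′ , (r , ⋃⊆I (k ℕ.+ k₀ , r∈) , r→r′) , x≤r′
    J⊆⋃ : members J ⊆ ⋃ ℕ (members ∘ t)
    J⊆⋃ j∈J with r′ , (r , r∈I , r→r′) , j≤r′ ← J⊆D j∈J
            with k , r∈ ← I⊆⋃ r∈I =
      k , downwardClosed (t k) j≤r′
        (successor∋ {s (k ℕ.+ k₀)} {J = t k}
          (chain-⊆ s (λ k → proj₁ (strict k)) (ℕ.m≤m+n k k₀) r∈) r→r′ (proj₂ (image k)))

  successors-level : ∀ {n I w J} → I Ŝ.—[ w ]→* J → InLevel n I → InLevel n J
  successors-level (Ŝ.done I≈J)    I-lvl = inLevel-resp I≈J I-lvl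
  successors-level {I = I} (Ŝ.step {y = J} I⇒J Js) I-lvl =
    successors-level Js (successor-level {I = I} {J = J} I⇒J I-lvl)

  deterministic* : ∀ {I I′ w J J′} → members I ≐ members I′ →
                   I Ŝ.—[ w ]→* J → I′ Ŝ.—[ w ]→* J′ → members J ≐ members J′
  deterministic* (I⊆I′ , I′⊆I) (Ŝ.done (I⊆J , J⊆I)) (Ŝ.done (I′⊆J′ , J′⊆I′)) =
    (λ x → I′⊆J′ (I⊆I′ (J⊆I x))) , (λ x → I⊆J (I′⊆I (J′⊆I′ x)))
  deterministic* {I} {I′} I≐I′ (Ŝ.step {y = K} I⇒K Ks) (Ŝ.step {y = K′} I′⇒K′ Ks′) =
    deterministic* (completionDeterministic {I′} {y = K} {K′}
      (⇒-resp {I} {I′} {J = K} {K} I≐I′ (id , id) I⇒K) I′⇒K′) Ks Ks′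

  -- Strict monotonicity propagates the growth of `I` under `w` to every iterate, so the iterates
  -- form a strict chain, and they keep the level of `I`.
  limit-level : ∀ {n I w K} → I GrowsBy w → members K ≐ Iterates w I →
                InLevel n I → InLevel (suc n) K
  limit-level {n} {I} {w} {K} (J , I⇒J , I⊂J) (K⊆ , ⊆K) I-lvl =
    union s levels strict
      ( (λ x∈K → let (k , J , I⇒J , x∈J) = K⊆ x∈K in
           -- Determinism identifies any ideal reached by `k` copies of `w` with `s k`.
           k , proj₁ (deterministic* {I} (id , id) I⇒J (reach k _)) x∈J)
      , λ (k , x∈) → ⊆K (k , s k , reach k _ , x∈))
    where
    Growing : Set₁
    Growing = Σ[ I ∈ Ideal ] I GrowsBy w
    next : Growing → Growing
    next (I , J , I⇒J , I⊂J) =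
      let (J′ , J⇒J′ , J⊂J′) = P̂.strictlyMonotone* completionStrictMonotone I⇒J I⊂J
      in J , J′ , J⇒J′ , J⊂J′
    open Orbit next
    s : ℕ → Ideal
    s k = proj₁ (iterate k (I , J , I⇒J , I⊂J))
    strict : ∀ k → members (s k) ⊂ members (s (suc k))
    strict k = orbit-step (λ G G′ → members (proj₁ G) ⊂ members (proj₁ G′))
                 (λ G → proj₂ (proj₂ (proj₂ G))) k _
    reach : ∀ k (G : Growing) → proj₁ G Ŝ.—[ concat (replicate k w) ]→* proj₁ (iterate k G)
    reach zero    G = Ŝ.done (id , id)
    reach (suc k) G = proj₁ (proj₂ (proj₂ G)) P̂.++→ reach k (next G)
    levels : ∀ k → InLevel n (s k)
    levels k = successors-level (reach k _) I-lvl

  -- Coverable ideals and repetition of positive words.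

  Coverable : State → Ideal → Set
  Coverable x I = ∀ {r} → r ∈ members I → ∃[ w ] ∃[ r′ ] x —[ w ]→* r′ × r ≤ r′

  -- The step is replayed by strong monotonicity from the reachable state that covers its source.
  coverable-successor : ∀ {x I a J} → Coverable x I → I =[ a ]⇒ J → Coverable x J
  coverable-successor cov (J⊆D , _) j∈J =
    let (r′ , (r , r∈I , r→r′) , j≤r′) = J⊆D j∈J
        (w , q , x→q , r≤q)           = cov r∈I
        (q′ , q→q′ , r′≤q′)           = stronglyMonotone r→r′ r≤q
    in w ++ _ , q′ , x→q ++→ single q→q′ , ≤-trans j≤r′ r′≤q′

  coverable-successors : ∀ {x I w J} → Coverable x I → I Ŝ.—[ w ]→* J → Coverable x J
  coverable-successors cov (Ŝ.done (_ , J⊆I)) j∈J = cov (J⊆I j∈J)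
  coverable-successors {I = I} cov (Ŝ.step {y = K} I⇒K Ks) =
    coverable-successors {I = K} (coverable-successor {I = I} {J = K} cov I⇒K) Ks

  coverable-limit : ∀ {x I w K} → Coverable x I → IsLimit w I (members K) → Coverable x K
  coverable-limit {I = I} cov (inj₁ (_ , K⊆ , _)) x∈K with k , J , I⇒J , x∈J ← K⊆ x∈K =
    coverable-successors {I = I} cov I⇒J x∈J
  coverable-limit cov (inj₂ (_ , K⊆I , _)) x∈K = cov (K⊆I x∈K)

  -- Built from the end: a state found in the next ideal lies below a true successor, from which
  -- monotonicity replays the remaining word. The run may thus end elsewhere than at `j`; what
  -- matters is that some member of `I` enables `w`.
  traceback : ∀ {I w J j} → I Ŝ.—[ w ]→* J → j ∈ members J →
              ∃[ r ] ∃[ r′ ] r ∈ members I × r —[ w ]→* r′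
  traceback (Ŝ.done (_ , J⊆I)) j∈J = _ , _ , J⊆I j∈J , done ≈.refl
  traceback (Ŝ.step (K⊆D , _) Ks) j∈J =
    let (q , _ , q∈K , qs)             = traceback Ks j∈J
        (p′ , (p , p∈I , p→p′) , q≤p′) = K⊆D q∈K
        (_ , ps , _)                   = monotone* stronglyMonotone qs q≤p′
    in p , _ , p∈I , step p→p′ ps

  repeat : ∀ {x y I w J} → Coverable x I → y ∈ members I → w ≢ [] →
           I Ŝ.—[ w ]→* J → PositiveWord w → RepeatedlyCoverable x y
  repeat {x} {y} {I} {w} {J} cov y∈I w≢[] I⇒J positive
    with _ , j∈J ← nonempty J
    with r , _ , r∈I , r→ ← traceback {I} I⇒J j∈J
    with z , z∈I , y≤z , r≤z ← directed I y∈I r∈I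
    with v , q , x→q , z≤q ← cov z∈I =
      z′ , (v , x→q) ,
      (λ i → w , w≢[] , orbit-step (λ p p′ → proj₁ p —[ w ]→* proj₁ p′)
                          (λ p → proj₁ (proj₂ (again p))) i start) ,
      λ i → proj₁ (proj₂ (iterate i start))
    where
    Above : Set
    Above = ∃[ p ] y ≤ p × r ≤ p
    -- Monotonicity shows only that `w` is enabled at `p`; positivity of `w` then supplies a run
    -- that ends above `p`.
    again : (p : Above) → PositiveFor (proj₁ p) w
    again (p , _ , r≤p) = let (p′ , p→ , _) = monotone* stronglyMonotone r→ r≤p in positive p (p′ , p→)
    next : Above → Above
    next p@(_ , y≤p , r≤p) = let (p′ , _ , p≤p′) = again p in p′ , ≤-trans y≤p p≤p′ , ≤-trans r≤p p≤p′
    open Orbit next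
    start : Above
    start = q , ≤-trans y≤z z≤q , ≤-trans r≤z z≤q
    z′ : ℕ → State
    z′ i = proj₁ (iterate i start)

-- The decision procedure

module _ {A : Set} where

  skip-middle : ∀ (us : List A) {vs ws} {v : A} → v ∈ᴸ us ++ ws → v ∈ᴸ (us ++ vs) ++ ws
  skip-middle us {vs} v∈ with ++⁻ us v∈
  ... | inj₁ v∈us = ++⁺ˡ (++⁺ˡ v∈us)
  ... | inj₂ v∈ws = ++⁺ʳ (us ++ vs) v∈ws

  skip-left : ∀ (us vs : List A) {ws} {v : A} → v ∈ᴸ vs ++ ws → v ∈ᴸ (us ++ vs) ++ ws
  skip-left us vs v∈ with ++⁻ vs v∈
  ... | inj₁ v∈vs = ++⁺ˡ (++⁺ʳ us v∈vs)
  ... | inj₂ v∈ws = ++⁺ʳ (us ++ vs) v∈ws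

  pull-cons : ∀ (us : List A) {u vs} {v : A} → v ∈ᴸ us ++ u ∷ vs → v ∈ᴸ u ∷ us ++ vs
  pull-cons us v∈ with ++⁻ us v∈
  ... | inj₁ v∈us         = there (++⁺ˡ v∈us)
  ... | inj₂ (here v≡u)   = here v≡u
  ... | inj₂ (there v∈vs) = there (++⁺ʳ us v∈vs)

module LayerAutomaton {m n : ℕ} (edge : Fin n → Fin m → Fin n → Bool) (k : Fin n) where

  -- The initial state is a copy of k that is not final, which excludes
  -- the empty word.
  source : Fin (suc n) → Fin n
  source zero    = k
  source (suc j) = j

  automaton : NFA m
  automaton = record
    { size    = suc n
    ; initial = λ { zero → true  ; (suc _) → false }
    ; final   = λ { zero → false ; (suc _) → true }
    ; δ       = λ { q a zero → false ; q a (suc j) → edge (source q) a j }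
    }

module Program {C : Class} (A : Algorithms C) (i : Class.Name C) (x y : Class.StateOf C i) where
  open Class C using (StateOf; LetterOf)
  open Algorithms A renaming (Code to CodeOf)

  Code : Set
  Code = CodeOf i

  letters : List (LetterOf i)
  letters = allFin _

  -- The letter, the word and the element of the successor list are all guessed.
  successor accelerated : Code → Enum Code
  successor u   = choose letters >>= λ a → run (successors i u a) >>= choose
  accelerated u = listOf (choose letters) >>= λ w → run (limit i u w)

  generation : ℕ → Enum Code
  generation zero    = run (principal i x)
  generation (suc n) = generation n >>= λ u →
    choose (true ∷ false ∷ []) >>= λ b → if b then successor u else accelerated u

  generated : Enum Code
  generated = naturals >>= generation

  included? equal? : Code → Code → Enum Bool
  included? u v = run (included i u v)
  equal? u v    = included? u v ∧ₑ included? v u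

  contains? : StateOf i → Code → Enum Bool
  contains? r u = run (principal i r) >>= λ c → included? c u

  closedLayer? : List Code → List Code → Enum Bool
  closedLayer? L R = all (λ u → all (λ a → run (successors i u a) >>=
    all (λ v → any (equal? v) L ∨ₑ any (included? v) R)) letters) L

  closed? : List (List Code) → Enum Bool
  closed? []       = return true
  closed? (L ∷ Ls) = closedLayer? L (concat Ls) ∧ₑ closed? Ls

  edges : (L : List Code) →
          Enum (Fin (length L) → LetterOf i → Fin (length L) → Bool)
  edges L = table λ k → table λ a → run (successors i (lookup L k) a) >>= λ vs →
            table λ j → any (equal? (lookup L j)) vs

  repeatable? : List Code → Enum Bool
  repeatable? L = edges L >>= λ edge → any (λ k →
    contains? y (lookup L k) ∧ₑ run (positive i (LayerAutomaton.automaton edge k))) (allFin _)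

  certified? : List (List Code) → Enum Bool
  certified? Ls = any (contains? x) (concat Ls) ∧ₑ closed? Ls

  -- A guess that is no certificate says nothing about `x` and `y`, so it must give no output rather
  -- than `false`.
  answer? : List (List Code) → Bool → Enum Bool
  answer? Ls certified = if certified then any repeatable? Ls else choose []

  program : Enum Bool
  program = listOf (listOf generated) >>= λ Ls → certified? Ls >>= answer? Ls

module Correctness
  (em : ExcludedMiddle (lsuc 0ℓ)) {C : Class} (A : Algorithms C) (i : Class.Name C)
  (post : Effectiveness.CompletionPostEffectiveAt A i)
  (lim : Effectiveness.∞-CompletionEffectiveAt A i)
  (pos : Effectiveness.PositiveEffectiveAt A i)
  (V : IsVeryWSTS (Class.system C i))
  (posS : TransitionSystem.Positive (Class.system C i))
  (x y : Class.StateOf C i) where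

  open Program A i x y
  open Algorithms A using (⟦_⟧; successors; limit)
  open Effectiveness.CompletionPostEffectiveAt post
  open TransitionSystem (Class.system C i)
  open Completion (Class.system C i)
  open IsPreorder isPreorder using () renaming
    (refl to ≤-refl; trans to ≤-trans; reflexive to ≤-reflexive; module Eq to ≈)
  open IsVeryWSTS V
  open Classical em
  open Paths (Class.system C i)
  open VeryWSTS em V

  -- The members are `⟦ u ⟧` itself, not those of the ideal from `sound`, so that facts about
  -- `ideal u` are definitionally facts about `⟦ u ⟧`.
  ideal : Code → Ideal
  ideal u = let (I , I⊆u , u⊆I) = sound u in record
    { members        = ⟦ u ⟧
    ; nonempty       = let (r , r∈I) = nonempty I in r , I⊆u r∈I
    ; downwardClosed = λ r≤s s∈u → I⊆u (downwardClosed I r≤s (u⊆I s∈u))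
    ; directed       = λ r∈u s∈u → let (z , z∈I , bounds) = directed I (u⊆I r∈u) (u⊆I s∈u)
                                   in z , I⊆u z∈I , bounds
    }

  -- Certificates and the correctness of their tests.

  Handled : List Code → List Code → Ideal → Set
  Handled L R J = Any (λ v → members J ≐ ⟦ v ⟧) L ⊎ Any (λ v → members J ⊆ ⟦ v ⟧) R

  handled-resp : ∀ {L R I J} → members I ≐ members J → Handled L R J → Handled L R I
  handled-resp I≐J       (inj₁ J≐) = inj₁ (Any.map (≐-trans I≐J) J≐)
  handled-resp (I⊆J , _) (inj₂ J⊆) = inj₂ (Any.map (λ J⊆v {r} r∈I → J⊆v {r} (I⊆J r∈I)) J⊆)

  handled-mono : ∀ {L L′ R R′ J} → (∀ {v} → v ∈ᴸ L → v ∈ᴸ L′) → (∀ {v} → v ∈ᴸ R → v ∈ᴸ R′) →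
                 Handled L R J → Handled L′ R′ J
  handled-mono L⊆ R⊆ (inj₁ J≐) = let (_ , v∈ , J≐v) = find J≐ in inj₁ (lose (L⊆ v∈) J≐v)
  handled-mono L⊆ R⊆ (inj₂ J⊆) = let (_ , v∈ , J⊆v) = find J⊆ in inj₂ (lose (R⊆ v∈) J⊆v)

  SuccessorsHandled : List Code → List Code → Code → Set₁
  SuccessorsHandled L R u = ∀ a J → ideal u =[ a ]⇒ J → Handled L R J

  data Closed : List (List Code) → Set₁ where
    []  : Closed []
    _∷_ : ∀ {L Ls} → All (SuccessorsHandled L (concat Ls)) L → Closed Ls → Closed (L ∷ Ls)

  Edge : (L : List Code) → Fin (length L) → Letter → Fin (length L) → Set₁
  Edge L k a j = ideal (lookup L k) =[ a ]⇒ ideal (lookup L j)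

  data Reads (L : List Code) : Fin (length L) → Word → Set₁ where
    []  : ∀ {k} → Reads L k []
    _∷_ : ∀ {k j a w} → Edge L k a j → Reads L j w → Reads L k (a ∷ w)

  Repeatable : List Code → Set₁
  Repeatable L = ∃[ k ] y ∈ ⟦ lookup L k ⟧ × (∃[ w ] (w ≢ [] × Reads L k w) × PositiveWord w)

  included-yields : ∀ u v → included? u v Yields Reflects (⟦ u ⟧ ⊆ ⟦ v ⟧)
  included-yields u v = run-yields (included-correct u v)

  equal-yields : ∀ u v → equal? u v Yields Reflects (⟦ u ⟧ ≐ ⟦ v ⟧)
  equal-yields u v = ∧-yields (included-yields u v) (included-yields v u)

  -- By downward closure, membership of `r` amounts to inclusion of its principal ideal.
  contains-yields : ∀ r u → contains? r u Yields Reflects (r ∈ ⟦ u ⟧)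
  contains-yields r u = >>=-yields (run-yields (principal-correct r)) λ c c≐↓r →
    weaken (reflects-⇔ (member c≐↓r)) (included-yields c u)
    where
    member : ∀ {c} → ⟦ c ⟧ ≐ ↓ (r ≡_) → ⟦ c ⟧ ⊆ ⟦ u ⟧ ⇔ r ∈ ⟦ u ⟧
    member (c⊆↓r , ↓r⊆c) = mk⇔
      (λ c⊆u → c⊆u (↓r⊆c (r , refl , ≤-refl)))
      (λ r∈u {_} s∈c → case c⊆↓r s∈c of λ { (_ , refl , s≤r) → downwardClosed (ideal u) s≤r r∈u })

  Represents : Code → Letter → List Code → Set₁
  Represents u a vs = ∀ J → ideal u =[ a ]⇒ J ⇔ Any (λ v → members J ≐ ⟦ v ⟧) vs

  successors-yields : ∀ u a → run (successors i u a) Yields Represents u a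
  successors-yields u a = run-yields (successors-correct u (ideal u) (id , id) a)

  closedLayer-yields : ∀ L R → closedLayer? L R Yields Reflects (All (SuccessorsHandled L R) L)
  closedLayer-yields L R = all-yields (λ u →
    weaken (reflects-⇔ (mk⇔ (λ h a → All.lookup h (∈-allFin a)) (λ h → All.tabulate λ {a} _ → h a)))
      (all-yields (λ a → >>=-yields (successors-yields u a) λ vs repr →
        weaken (reflects-⇔ (allHandled repr))
          (all-yields (λ v → ∨-yields (any-yields (equal-yields v) L) (any-yields (included-yields v) R)) vs))
        letters)) L
    where
    allHandled : ∀ {u a vs} → Represents u a vs →
                 All (λ v → Handled L R (ideal v)) vs ⇔ (∀ J → ideal u =[ a ]⇒ J → Handled L R J)
    allHandled {u} {a} {vs} repr = mk⇔
      (λ h J u⇒J → let (v , v∈ , J≐v) = find (Equivalence.to (repr J) u⇒J)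
                   in handled-resp {L} {R} {J} {ideal v} J≐v (All.lookup h v∈))
      (λ h → All.tabulate λ {v} v∈ → h (ideal v) (Equivalence.from (repr (ideal v)) (lose v∈ (id , id))))

  closed-yields : ∀ Ls → closed? Ls Yields Reflects (Closed Ls)
  closed-yields []       = return-yields (of [])
  closed-yields (L ∷ Ls) = weaken (reflects-⇔ (mk⇔ (λ (h , c) → h ∷ c) λ { (h ∷ c) → h , c }))
    (∧-yields (closedLayer-yields L (concat Ls)) (closed-yields Ls))

  edges-yields : ∀ L → edges L Yields λ edge → ∀ k a j → Reflects (Edge L k a j) (edge k a j)
  edges-yields L = table-yields λ k → table-yields λ a →
    >>=-yields (successors-yields (lookup L k) a) λ vs repr → table-yields λ j →
    weaken (reflects-⇔ (mk⇔ (Equivalence.from (repr (ideal (lookup L j))))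
                            (Equivalence.to (repr (ideal (lookup L j))))))
      (any-yields (equal-yields (lookup L j)) vs)

  module _ {L} {edge : Fin (length L) → Letter → Fin (length L) → Bool}
           (edge-reflects : ∀ k a j → Reflects (Edge L k a j) (edge k a j)) (k : Fin (length L)) where
    open LayerAutomaton edge k
    open NFA automaton using (AcceptsFrom; Accepts; final)

    T⇒ : ∀ {P : Set₁} {b} → Reflects P b → T b → P
    T⇒ (ofʸ p) _ = p

    ⇒T : ∀ {P : Set₁} {b} → Reflects P b → P → T b
    ⇒T (ofʸ _)  _ = _
    ⇒T (ofⁿ ¬p) p = ¬p p

    acceptsFrom⇒reads : ∀ q w → AcceptsFrom q w → Reads L (source q) w
    acceptsFrom⇒reads q []      _ = []
    acceptsFrom⇒reads q (a ∷ w) (suc j , qaj , acc) =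
      T⇒ (edge-reflects (source q) a j) qaj ∷ acceptsFrom⇒reads (suc j) w acc

    -- The hypothesis on `[]` matters only at the initial copy of `k`; after one letter the state is
    -- final and it holds trivially.
    reads⇒acceptsFrom : ∀ q w → (w ≡ [] → T (final q)) → Reads L (source q) w → AcceptsFrom q w
    reads⇒acceptsFrom q []      fin []       = fin refl
    reads⇒acceptsFrom q (a ∷ w) _   (e ∷ es) =
      suc _ , ⇒T (edge-reflects (source q) a _) e , reads⇒acceptsFrom (suc _) w _ es

    accepts⇔reads : ∀ w → Accepts w ⇔ (w ≢ [] × Reads L k w)
    accepts⇔reads w = mk⇔
      (λ { (zero , _ , acc) → (λ { refl → acc }) , acceptsFrom⇒reads zero w acc })
      (λ (w≢[] , rs) → zero , _ , reads⇒acceptsFrom zero w (⊥-elim ∘ w≢[]) rs)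

  repeatable-yields : ∀ L → repeatable? L Yields Reflects (Repeatable L)
  repeatable-yields L = >>=-yields (edges-yields L) λ edge refl-edge →
    weaken (reflects-⇔ (mk⇔ Any.satisfied λ (k , h) → lose (∈-allFin k) h))
      (any-yields (λ k → ∧-yields (contains-yields y (lookup L k))
        (weaken (reflects-⇔ (mk⇔
            (λ (w , acc , w-pos) → w , Equivalence.to (accepts⇔reads refl-edge k w) acc , w-pos)
            (λ (w , rs , w-pos) → w , Equivalence.from (accepts⇔reads refl-edge k w) rs , w-pos)))
          (run-yields (pos _))))
        (allFin _))

  -- Soundness of certificates made of generated ideals.

  generation-grows : ∀ {u v} b → u ∈ₑ generated → v ∈ₑ (if b then successor u else accelerated u) →
                     v ∈ₑ generated
  generation-grows b u∈ v∈ with n , _ , u∈ₙ ← >>=-∈ {e = naturals} {generation} u∈ =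
    ∈->>= {e = naturals} {generation} {suc n} (output _ (here refl))
      (∈->>= u∈ₙ (∈->>= {v = b} (∈-choose (bool∈ b)) v∈))
    where
    bool∈ : ∀ b → b ∈ᴸ true ∷ false ∷ []
    bool∈ true  = here refl
    bool∈ false = there (here refl)

  successor-generated : ∀ {u a vs v} → u ∈ₑ generated → vs ∈ₑ run (successors i u a) → v ∈ᴸ vs →
                        v ∈ₑ generated
  successor-generated {a = a} u∈ vs∈ v∈ = generation-grows true u∈
    (∈->>= (∈-choose (∈-allFin a)) (∈->>= vs∈ (∈-choose v∈)))

  limit-generated : ∀ {u w v} → u ∈ₑ generated → v ∈ₑ run (limit i u w) → v ∈ₑ generated
  limit-generated u∈ v∈ = generation-grows false u∈
    (∈->>= (∈-listOf (All.tabulate λ {a} _ → ∈-choose (∈-allFin a))) v∈)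

  generated-coverable : ∀ {u} → u ∈ₑ generated → Coverable x (ideal u)
  generated-coverable u∈ with n , _ , u∈ₙ ← >>=-∈ {e = naturals} {generation} u∈ = go n u∈ₙ
    where
    go : ∀ n {u} → u ∈ₑ generation n → Coverable x (ideal u)
    go zero u∈ r∈u with _ , refl , r≤x ← proj₁ (proj₂ (run-yields (principal-correct x)) _ u∈) r∈u =
      [] , x , done ≈.refl , r≤x
    go (suc n) {u} u∈
      with t , t∈ , u∈′ ← >>=-∈ {e = generation n} u∈
      with >>=-∈ {e = choose (true ∷ false ∷ [])} u∈′
    ... | true , _ , u∈s
      with a , _ , u∈a ← >>=-∈ {e = choose letters} u∈s
      with vs , vs∈ , output _ u∈vs ← >>=-∈ {e = run (successors i t a)} u∈a =
      coverable-successor {I = ideal t} {J = ideal u} (go n t∈)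
        (Equivalence.from (proj₂ (successors-yields t a) vs vs∈ (ideal u)) (lose u∈vs (id , id)))
    ... | false , _ , u∈l
      with w , _ , u∈w ← >>=-∈ {e = listOf (choose letters)} u∈l =
      coverable-limit {I = ideal t} {K = ideal u} (go n t∈)
        (proj₂ (run-yields (lim t (ideal t) (id , id) w)) _ u∈w)

  reads⇒path : ∀ {L k w} → Reads L k w → ∃[ J ] ideal (lookup L k) Ŝ.—[ w ]→* J
  reads⇒path {L} {k} [] = ideal (lookup L k) , Ŝ.done (id , id)
  reads⇒path {L} (_∷_ {j = j} e es) =
    let (J , Js) = reads⇒path es in J , Ŝ.step {y = ideal (lookup L j)} e Js

  repeatable-sound : ∀ {L} → All (_∈ₑ generated) L → Repeatable L → RepeatedlyCoverable x y
  repeatable-sound {L} L∈ (k , y∈k , w , (w≢[] , rs) , w-pos) =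
    repeat {I = ideal (lookup L k)} (generated-coverable (All.lookup L∈ (∈-lookup k)))
      y∈k w≢[] (proj₂ (reads⇒path rs)) w-pos

  -- Completeness: runs through closed layers.

  Within : List Code → State → Set
  Within R r = Any (λ u → r ∈ ⟦ u ⟧) R

  handled-within : ∀ {L R J r} → r ∈ members J → Handled L R J → Within L r ⊎ Within R r
  handled-within r∈J (inj₁ J≐) = inj₁ (Any.map (λ (J⊆v , _) → J⊆v r∈J) J≐)
  handled-within r∈J (inj₂ J⊆) = inj₂ (Any.map (λ J⊆v → J⊆v r∈J) J⊆)

  within-step : ∀ {Ls r a q} → Closed Ls → Within (concat Ls) r → r —[ a ]→ q → Within (concat Ls) q
  within-step {L ∷ Ls} (h ∷ c) r∈ r→q with ++⁻ L r∈
  ... | inj₂ r∈Ls = ++⁺ʳ L (within-step c r∈Ls r→q)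
  ... | inj₁ r∈L
    with u , u∈ , r∈u ← find r∈L
    with J , u⇒J , q∈J ← successorAround {ideal u} r∈u r→q
    with handled-within {J = J} q∈J (All.lookup h u∈ _ J u⇒J)
  ... | inj₁ q∈L  = ++⁺ˡ q∈L
  ... | inj₂ q∈Ls = ++⁺ʳ L q∈Ls

  within-resp : ∀ {R r q} → r ≈ q → Within R r → Within R q
  within-resp r≈q = Any.map λ {u} r∈u → downwardClosed (ideal u) (≤-reflexive (≈.sym r≈q)) r∈u

  within-steps : ∀ {Ls r w q} → Closed Ls → Within (concat Ls) r → r —[ w ]→* q → Within (concat Ls) q
  within-steps c r∈ (done r≈q)   = within-resp r≈q r∈
  within-steps c r∈ (step r→ qs) = within-steps c (within-step c r∈ r→) qs

  -- As long as successor ideals equal ideals of the layer, the run traces edges. The first one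
  -- merely included in a later layer carries the rest of the run into the later layers.
  reads-or-leaves : ∀ {L Ls r w q} → Closed (L ∷ Ls) → ∀ k → r ∈ ⟦ lookup L k ⟧ → r —[ w ]→* q →
                    Reads L k w ⊎ Within (concat Ls) q
  reads-or-leaves c k r∈k (done _) = inj₁ []
  reads-or-leaves {L} {Ls} (h ∷ c) k r∈k (step {a = a} r→ qs)
    with J , k⇒J , p∈J ← successorAround {ideal (lookup L k)} r∈k r→
    with All.lookup h (∈-lookup k) a J k⇒J
  ... | inj₂ J⊆ = inj₂ (within-steps c (Any.map (λ J⊆v → J⊆v p∈J) J⊆) qs)
  ... | inj₁ J≐
    with reads-or-leaves (h ∷ c) (index J≐) (proj₁ (lookup-index J≐) p∈J) qs
  -- Successors are invariant under extensional equality, so the step to `J` is an edge to the equal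
  -- ideal of the layer.
  ... | inj₁ rs = inj₁ (⇒-resp {I} {I} {a} {J} {ideal (lookup L (index J≐))}
                          (id , id) (lookup-index J≐) k⇒J ∷ rs)
    where
    I : Ideal
    I = ideal (lookup L k)
  ... | inj₂ q∈ = inj₂ q∈

  Run : (ℕ → State) → Set
  Run z = ∀ k → ∃[ w ] w ≢ [] × z k —[ w ]→* z (suc k)

  run-segment : ∀ {z} → Run z → ∀ {k l} → k ℕ.< l → ∃[ w ] w ≢ [] × z k —[ w ]→* z l
  run-segment {z} steps k<l = go (ℕ.≤⇒≤′ k<l)
    where
    go : ∀ {k l} → suc k ℕ.≤′ l → ∃[ w ] w ≢ [] × z k —[ w ]→* z l
    go (ℕ.≤′-reflexive refl)  = steps _
    go (ℕ.≤′-step k<l) with go k<l | steps _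
    ... | []    , []≢[] , _  | _          = contradiction refl []≢[]
    ... | a ∷ w , _     , ps | _ , _ , qs = _ , (λ ()) , ps ++→ qs

  within-run : ∀ {Ls z} → Closed Ls → Run z → Within (concat Ls) (z 0) → ∀ k → Within (concat Ls) (z k)
  within-run c steps z₀∈ zero    = z₀∈
  within-run c steps z₀∈ (suc k) =
    within-steps c (within-run c steps z₀∈ k) (proj₂ (proj₂ (steps k)))

  -- Induction on the layers finds the one in which the run finally stays: either some state lies in
  -- the later layers, and the tail from there is treated, or the run never leaves `L`.
  repeatable-complete : ∀ {Ls} → Closed Ls → (z : ℕ → State) → Run z → (∀ k → y ≤ z k) →
                        Within (concat Ls) (z 0) → Any Repeatable Ls
  repeatable-complete {L ∷ Ls} (h ∷ c) z steps y≤z z₀∈ with em₀ {∃[ k ] Within (concat Ls) (z k)}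
  ... | yes (k , zₖ∈) = there (repeatable-complete c (λ l → z (l ℕ.+ k)) (λ l → steps (l ℕ.+ k))
                                (λ l → y≤z (l ℕ.+ k)) zₖ∈)
  ... | no stays
    with k , l , k<l , zₖ≤zₗ ← proj₁ isWSTS z
    with w , w≢[] , ws ← run-segment steps k<l
    with ++⁻ L (within-run (h ∷ c) steps z₀∈ k)
  ... | inj₂ zₖ∈ = contradiction (k , zₖ∈) stays
  ... | inj₁ zₖ∈
    with reads-or-leaves (h ∷ c) (index zₖ∈) (lookup-index zₖ∈) ws
  ... | inj₂ zₗ∈ = contradiction (l , zₗ∈) stays
  -- `z k ≤ z l` makes `w` positive for `z k`, and `posS` extends this to all states.
  ... | inj₁ rs = here (index zₖ∈ , downwardClosed (ideal _) (y≤z k) (lookup-index zₖ∈) ,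
                        w , (w≢[] , rs) , posS w (z k , z l , ws , zₖ≤zₗ))

  -- Karp-Miller exploration of one layer.

  Generated : ℕ → Code → Set₁
  Generated n u = u ∈ₑ generated × InLevel n (ideal u)

  -- A partial layer below the ancestors `path`: successors may also equal ancestors, which join the
  -- layer only when the recursion returns to them. `limits` seeds the next layer.
  record Explored (n : ℕ) (path us : List Code) : Set₁ where
    field
      layer         : List Code
      limits        : List Code
      layer-ok      : All (Generated n) layer
      limits-ok     : All (Generated (suc n)) limits
      layer-closed  : All (SuccessorsHandled (layer ++ path) limits) layer
      start-handled : All (Handled (layer ++ path) limits ∘ ideal) us

  open Explored

  exploreAll : ∀ {n path} us → (∀ {u} → u ∈ᴸ us → Explored n path (u ∷ [])) → Explored n path us
  exploreAll [] _ = record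
    { layer = [] ; limits = [] ; layer-ok = [] ; limits-ok = [] ; layer-closed = [] ; start-handled = [] }
  exploreAll {n} {path} (u ∷ us) explore = record
    { layer         = layer E ++ layer F
    ; limits        = limits E ++ limits F
    ; layer-ok      = All.++⁺ (layer-ok E) (layer-ok F)
    ; limits-ok     = All.++⁺ (limits-ok E) (limits-ok F)
    ; layer-closed  = All.++⁺
        (All.map (λ h a J u⇒J → left {J} (h a J u⇒J)) (layer-closed E))
        (All.map (λ h a J u⇒J → right {J} (h a J u⇒J)) (layer-closed F))
    ; start-handled = All.++⁺
        (All.map (λ {v} → left {ideal v}) (start-handled E))
        (All.map (λ {v} → right {ideal v}) (start-handled F))
    }
    where
    E : Explored n path (u ∷ [])
    E = explore (here refl)
    F : Explored n path us
    F = exploreAll us (explore ∘ there)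
    left : ∀ {J} → Handled (layer E ++ path) (limits E) J →
           Handled ((layer E ++ layer F) ++ path) (limits E ++ limits F) J
    left {J} = handled-mono {J = J} (skip-middle (layer E)) ++⁺ˡ
    right : ∀ {J} → Handled (layer F ++ path) (limits F) J →
            Handled ((layer E ++ layer F) ++ path) (limits E ++ limits F) J
    right {J} = handled-mono {J = J} (skip-left (layer E) (layer F)) (++⁺ʳ (limits E))

  -- Paths are listed backwards.
  data Bar : List Code → Set where
    stop   : ∀ {u us} → Any (λ t → ⟦ t ⟧ ⊆ ⟦ u ⟧) us → Bar (u ∷ us)
    extend : ∀ {us} → (∀ u → Bar (u ∷ us)) → Bar us

  -- Otherwise unbarred paths extend forever, and their codes form a sequence that violates the
  -- well-quasi-ordering of ideals. In inductive form, finiteness of paths drives the recursion of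
  -- `explore`.
  bar : Bar []
  bar = decidable-stable em₀ λ ¬bar →
    let (k , l , k<l , sₖ⊆sₗ) = proj₁ completionIsWSTS (λ k → ideal (newest ¬bar k))
    in proj₂ (prefix ¬bar (suc l)) (stop (lose (newest∈ ¬bar (ℕ.≤⇒≤′ k<l)) sₖ⊆sₗ))
    where
    Unbarred : Set
    Unbarred = ∃[ us ] ¬ Bar us
    escape : (us : Unbarred) → ∃[ u ] ¬ Bar (u ∷ proj₁ us)
    escape (us , ¬bar) = decidable-stable em₀ λ none →
      ¬bar (extend λ u → decidable-stable em₀ λ ¬bar′ → none (u , ¬bar′))
    module _ (¬bar : ¬ Bar []) where
      prefix : ℕ → Unbarred
      prefix zero    = [] , ¬bar
      prefix (suc k) = let (u , ¬bar′) = escape (prefix k) in u ∷ proj₁ (prefix k) , ¬bar′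
      newest : ℕ → Code
      newest k = proj₁ (escape (prefix k))
      newest∈ : ∀ {k l} → suc k ℕ.≤′ l → newest k ∈ᴸ proj₁ (prefix l)
      newest∈ (ℕ.≤′-reflexive refl) = here refl
      newest∈ (ℕ.≤′-step k<l)       = there (newest∈ k<l)

  Leads : Code → Code → Set₁
  Leads t u = ∃[ w ] ideal t Ŝ.—[ w ]→* ideal u

  -- The words from the ancestors to `u` are kept in `path-ok`, since the one from an included
  -- ancestor `t` is the word to accelerate.
  explore : ∀ {n u path} → Bar (u ∷ path) → Generated n u →
            All (λ t → Generated n t × Leads t u) path → Explored n path (u ∷ [])
  explore {n} {u} {path} (stop t⊆) u-ok path-ok
    with t , t∈ , t⊆u ← find t⊆
    with em₀ {⟦ u ⟧ ⊆ ⟦ t ⟧}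
  -- Equality with an ancestor: `u` is handled by `path`.
  ... | yes u⊆t = record
    { layer = [] ; limits = [] ; layer-ok = [] ; limits-ok = [] ; layer-closed = []
    ; start-handled = inj₁ (lose t∈ (u⊆t , t⊆u)) ∷ [] }
  ... | no u⊈t
    with (t-gen , t-lvl) , w , t→u ← All.lookup path-ok t∈
    with (v , v∈) , correct ← run-yields (lim t (ideal t) (id , id) w)
    with correct v v∈
  -- The inclusion of `t` in `u` is strict and `w` leads from `t` to `u`, so `t` grows by `w`.
  ... | inj₂ (stuck , _) = ⊥-elim (stuck (ideal u , t→u , t⊆u , u⊈t))
  ... | inj₁ (grows , v≐) = record
    { layer = [] ; limits = v ∷ [] ; layer-ok = []
    ; limits-ok = (limit-generated t-gen v∈ , limit-level {I = ideal t} {K = ideal v} grows v≐ t-lvl) ∷ []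
    ; layer-closed = []
    -- `u` is the first iterate, hence included in the limit; one copy of `w` concatenates to
    -- `w ++ []`.
    ; start-handled = inj₂ (here (λ r∈u → proj₂ v≐ (1 , ideal u ,
        subst (λ w → ideal t Ŝ.—[ w ]→* ideal u) (sym (++-identityʳ w)) t→u , r∈u))) ∷ [] }
  explore {n} {u} {path} (extend bars) (u-gen , u-lvl) path-ok = record
    { layer         = u ∷ layer E
    ; limits        = limits E
    ; layer-ok      = (u-gen , u-lvl) ∷ layer-ok E
    ; limits-ok     = limits-ok E
    ; layer-closed  =
        (λ a J u⇒J →
          let (v , v∈ , J≐v) = find (Equivalence.to (images-represent a J) u⇒J)
          in move {J} (handled-resp {I = J} {ideal v} J≐v
               (All.lookup (start-handled E) (∈-concatMap⁺ images (lose (∈-allFin a) v∈))))) ∷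
        All.map (λ h a J t⇒J → move {J} (h a J t⇒J)) (layer-closed E)
    ; start-handled = inj₁ (here (id , id)) ∷ []
    }
    where
    images : Letter → List Code
    images a = proj₁ (proj₁ (successors-yields u a))
    images∈ : ∀ a → images a ∈ₑ run (successors i u a)
    images∈ a = proj₂ (proj₁ (successors-yields u a))
    images-represent : ∀ a → Represents u a (images a)
    images-represent a = proj₂ (successors-yields u a) (images a) (images∈ a)
    child : ∀ {v} → v ∈ᴸ concatMap images letters → Explored n (u ∷ path) (v ∷ [])
    child {v} v∈
      with a , _ , v∈a ← find (∈-concatMap⁻ images {xs = letters} v∈)
      with u⇒v ← Equivalence.from (images-represent a (ideal v)) (lose v∈a (id , id)) =
      explore (bars v)
        (successor-generated u-gen (images∈ a) v∈a , successor-level {I = ideal u} {J = ideal v} u⇒v u-lvl)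
        (((u-gen , u-lvl) , a ∷ [] , P̂.single {ideal u} {ideal v} u⇒v) ∷
         All.map (λ (t-ok , w , t→u) → t-ok , w ++ a ∷ [] , t→u P̂.++→ P̂.single {ideal u} {ideal v} u⇒v) path-ok)
    E : Explored n (u ∷ path) (concatMap images letters)
    E = exploreAll _ child
    -- Here `u` passes from the ancestors into the layer.
    move : ∀ {J} → Handled (layer E ++ u ∷ path) (limits E) J → Handled (u ∷ layer E ++ path) (limits E) J
    move {J} = handled-mono {J = J} (pull-cons (layer E)) id

  -- Stacking the layers.

  rootBar : ∀ u → Bar (u ∷ [])
  -- `bar` must be an `extend`, because `stop` bars only nonempty paths.
  rootBar = go bar refl
    where
    go : ∀ {us} → Bar us → us ≡ [] → ∀ u → Bar (u ∷ [])
    go (extend bars) refl = bars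

  ClosedLayersAbove : List Code → Set₁
  ClosedLayersAbove us = ∃[ Ls ] All (All (_∈ₑ generated)) Ls × Closed Ls ×
                         All (λ u → Any (λ v → ⟦ u ⟧ ⊆ ⟦ v ⟧) (concat Ls)) us

  -- With no ancestors outstanding, the layer handles its exact successors itself. The other
  -- successors lie below limits, hence below ideals of `Ls` by transitivity.
  addLayer : ∀ {n us} (E : Explored n [] us) → ClosedLayersAbove (limits E) → ClosedLayersAbove us
  addLayer E (Ls , Ls-gen , closed , above) =
    layer E ∷ Ls , All.map proj₁ (layer-ok E) ∷ Ls-gen ,
    All.map (λ h a J u⇒J → settle {J} (h a J u⇒J)) (layer-closed E) ∷ closed ,
    All.map (λ {u} h → dominate {ideal u} (settle {ideal u} h)) (start-handled E)
    where
    settle : ∀ {J} → Handled (layer E ++ []) (limits E) J → Handled (layer E) (concat Ls) J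
    settle (inj₁ J≐) = inj₁ (subst (Any _) (++-identityʳ (layer E)) J≐)
    settle (inj₂ J⊆) with u , u∈ , J⊆u ← find J⊆ =
      inj₂ (Any.map (λ u⊆v {r} r∈J → u⊆v {r} (J⊆u r∈J)) (All.lookup above u∈))
    dominate : ∀ {J} → Handled (layer E) (concat Ls) J →
               Any (λ v → members J ⊆ ⟦ v ⟧) (layer E ++ concat Ls)
    dominate (inj₁ J≐) = ++⁺ˡ (Any.map proj₁ J≐)
    dominate (inj₂ J⊆) = ++⁺ʳ (layer E) J⊆

  -- `d` bounds the levels left above `n`. Each layer raises the level of its seeds by one, and at
  -- the empty level no seed can remain.
  closedLayers : ∀ d n → (∀ I → ¬ InLevel (d ℕ.+ n) I) → ∀ {us} → All (Generated n) us →
                 ClosedLayersAbove us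
  closedLayers zero    n empty []                = [] , [] , [] , []
  closedLayers zero    n empty ((_ , u-lvl) ∷ _) = ⊥-elim (empty _ u-lvl)
  closedLayers (suc d) n empty {us} us-ok = addLayer E
    (closedLayers d (suc n) (subst (λ N → ∀ I → ¬ InLevel N I) (sym (ℕ.+-suc d n)) empty) (limits-ok E))
    where
    E : Explored n [] us
    E = exploreAll us λ u∈ → explore (rootBar _) (All.lookup us-ok u∈) []

  closedLayers-exist : ∃[ Ls ] All (All (_∈ₑ generated)) Ls × Closed Ls × Within (concat Ls) x
  closedLayers-exist
    with N , empty ← finitelyManyLevels
    with (u , u∈) , u-principal ← run-yields (principal-correct x)
    with Ls , Ls-gen , closed , above ∷ [] ← closedLayers N 0
           (subst (λ n → ∀ I → ¬ InLevel n I) (sym (ℕ.+-identityʳ N)) empty)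
           ((∈->>= {e = naturals} {generation} {0} (output _ (here refl)) u∈ , base) ∷ []) =
      Ls , Ls-gen , closed ,
      Any.map (λ u⊆v → u⊆v (proj₂ (u-principal u u∈) (x , refl , ≤-refl))) above

  -- Correctness of the program.

  certified-yields : ∀ Ls → certified? Ls Yields Reflects (Within (concat Ls) x × Closed Ls)
  certified-yields Ls = ∧-yields (any-yields (contains-yields x) (concat Ls)) (closed-yields Ls)

  repeatable⇔repeatedlyCoverable : ∀ {Ls} → All (All (_∈ₑ generated)) Ls → Within (concat Ls) x → Closed Ls →
                                   Any Repeatable Ls ⇔ RepeatedlyCoverable x y
  repeatable⇔repeatedlyCoverable Ls-gen x∈ closed = mk⇔
    (λ reps → let (_ , L∈ , rep) = find reps in repeatable-sound (All.lookup Ls-gen L∈) rep)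
    (λ (z , (w , x→z₀) , steps , y≤z) →
       repeatable-complete closed z steps y≤z (within-steps closed x∈ x→z₀))

  answer-correct : ∀ {Ls c b} → All (All (_∈ₑ generated)) Ls →
                   Reflects (Within (concat Ls) x × Closed Ls) c → b ∈ₑ answer? Ls c →
                   Reflects (RepeatedlyCoverable x y) b
  answer-correct {Ls} Ls-gen (ofʸ (x∈ , closed)) b∈ =
    reflects-⇔ (repeatable⇔repeatedlyCoverable Ls-gen x∈ closed)
      (proj₂ (any-yields repeatable-yields Ls) _ b∈)
  answer-correct _ (ofⁿ _) (output _ ())

  answer-exists : ∀ {Ls c} → Within (concat Ls) x × Closed Ls →
                  Reflects (Within (concat Ls) x × Closed Ls) c → ∃[ b ] b ∈ₑ answer? Ls c
  answer-exists {Ls} _  (ofʸ _)   = proj₁ (any-yields repeatable-yields Ls)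
  answer-exists      ok (ofⁿ ¬ok) = contradiction ok ¬ok

  program-correct : ∀ b → b ∈ₑ program → Reflects (RepeatedlyCoverable x y) b
  program-correct b b∈ =
    let (Ls , Ls∈ , b∈Ls) = >>=-∈ {e = listOf (listOf generated)} {λ Ls → certified? Ls >>= answer? Ls} b∈
        (c , c∈ , b∈c)    = >>=-∈ {e = certified? Ls} {answer? Ls} b∈Ls
    in answer-correct (All.map listOf-∈ (listOf-∈ Ls∈)) (proj₂ (certified-yields Ls) c c∈) b∈c

  -- The certificate is known to exist only classically, yet the program meets it because it
  -- enumerates all lists of lists of generated codes.
  program-halts : ∃[ Ls ] All (All (_∈ₑ generated)) Ls × Closed Ls × Within (concat Ls) x → ∃[ b ] b ∈ₑ program
  program-halts (Ls , Ls-gen , closed , x∈) =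
    let ((c , c∈) , c-correct) = certified-yields Ls
        (b , b∈)               = answer-exists (x∈ , closed) (c-correct c c∈)
    in b , ∈->>= {e = listOf (listOf generated)} {λ Ls → certified? Ls >>= answer? Ls}
             (∈-listOf (All.map ∈-listOf Ls-gen))
             (∈->>= {e = certified? Ls} {answer? Ls} c∈ b∈)

  program-yields : program Yields Reflects (RepeatedlyCoverable x y)
  program-yields = program-halts closedLayers-exist , program-correct

theorem18 : (C : Class) (A : Algorithms C) →
    Σ[ decide ∈ ((i : Class.Name C) → Class.StateOf C i → Class.StateOf C i → Computation Bool) ]
    (ExcludedMiddle (lsuc 0ℓ) →
    Effectiveness.CompletionPostEffective A →
    Effectiveness.∞-CompletionEffective A →
    Effectiveness.PositiveEffective A →
    (∀ i → IsVeryWSTS (Class.system C i)) →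
    (∀ i → TransitionSystem.Positive (Class.system C i)) →
    ∀ i x y → decide i x y Decides TransitionSystem.RepeatedlyCoverable (Class.system C i) x y)
theorem18 C A =
  -- The procedure is fixed from `A` alone, before excluded middle and the correctness hypotheses
  -- are assumed.
  (λ i x y → first (Program.program A i x y)) ,
  λ em post lim pos very positive i x y →
    first-computes (Correctness.program-yields em A i (post i) (lim i) (pos i) (very i) (positive i) x y)
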